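{- The set $\mathcal{LP}_4$ is formed by exactly two isotopism classes, which are respectively the sets $\mathcal{LP}_{4,1}\sqcup\mathcal{LP}_{4,2}$ and $\mathcal{LP}_{4,4}$.
   Context: $\mathbb{F}_4$ is the field with four elements. $\mathcal{P}_4$ is the set of polynomials in $\mathbb{F}_4[x]$ of degree less than $4$ that act as permutations of $\mathbb{F}_4$. $\mathcal{LP}_4$ is the set of polynomials $f\in\mathbb{F}_4[x,y]$ of degree less than $4$ in each variable such that, for every $a\in\mathbb{F}_4$, both $f(x,a)$ and $f(a,x)$ act as permutations of $\mathbb{F}_4$. $\mathcal{LP}_{4,d}$ is the subset of polynomials of total degree $d$ in $\mathcal{LP}_4$. A polynomial $f\in\mathcal{LP}_4$ is isotopic to $g\in\mathcal{LP}_4$ if $g(h_1(x),h_2(y))=h_3(f(x,y))$ for some $h_1,h_2,h_3\in\mathcal{P}_4$, compositions being taken modulo $x^4-x$ and $y^4-y$; this is an equivalence relation, whose classes are called isotopism classes. -}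

module Defs where

open import Algebra.Bundles using (CommutativeRing)
import Algebra.Properties.Semiring.Exp as SemiringExp
import Algebra.Properties.Semiring.Sum as SemiringSum
open import Algebra.Structures using (IsCommutativeRing)
open import Data.Fin.Base using (Fin; zero; suc; toℕ)
open import Data.Fin.Properties renaming (_≟_ to _≟ᶠ_) using ()
open import Data.List.Base
  using (List; []; _∷_; _++_; allFin; cartesianProductWith; filter; foldr; map)
open import Data.Nat.Base as ℕ using (ℕ; zero; suc; _≤_)
open import Data.Nat.DivMod using (_mod_)
open import Data.Product.Base using (∃-syntax; _×_; _,_)
open import Data.Vec.Base using (Vec; lookup; tabulate)
open import Function.Definitions using (Bijective)
open import Level using (0ℓ)
open import Relation.Binary.PropositionalEquality
  using (_≡_; _≢_; refl; sym; subst; cong; cong₂; isEquivalence)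
open import Relation.Nullary.Decidable
  using (Dec; map′; from-yes; _×-dec_)
open import Relation.Unary using (Pred; Decidable; _≐_)

-- 𝔽₄ = 𝔽₂[ω] / (ω² + ω + 1), with ω̄ = ω² = ω + 1.

data 𝔽₄ : Set where
  0# 1# ω ω̄ : 𝔽₄

infixl 6 _+_
infixl 7 _*_

_+_ : 𝔽₄ → 𝔽₄ → 𝔽₄
0# + b  = b
a  + 0# = a
1# + 1# = 0#
1# + ω  = ω̄
1# + ω̄  = ω
ω  + 1# = ω̄
ω  + ω  = 0#
ω  + ω̄  = 1#
ω̄  + 1# = ω
ω̄  + ω  = 1#
ω̄  + ω̄  = 0#

_*_ : 𝔽₄ → 𝔽₄ → 𝔽₄
0# * _  = 0#
1# * b  = b
ω  * 0# = 0#
ω  * 1# = ω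
ω  * ω  = ω̄
ω  * ω̄  = 1#
ω̄  * 0# = 0#
ω̄  * 1# = ω̄
ω̄  * ω  = 1#
ω̄  * ω̄  = ω

-- Characteristic 2.
-_ : 𝔽₄ → 𝔽₄
- a = a

infix 4 _≟_

_≟_ : (a b : 𝔽₄) → Dec (a ≡ b)
a ≟ b = map′ (toFin-injective a b) (cong toFin) (toFin a ≟ᶠ toFin b)
  where
  toFin : 𝔽₄ → Fin 4
  toFin 0# = zero
  toFin 1# = suc zero
  toFin ω  = suc (suc zero)
  toFin ω̄  = suc (suc (suc zero))

  fromFin : Fin 4 → 𝔽₄
  fromFin zero                   = 0#
  fromFin (suc zero)             = 1#
  fromFin (suc (suc zero))       = ω
  fromFin (suc (suc (suc zero))) = ω̄

  fromFin-toFin : ∀ c → fromFin (toFin c) ≡ c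
  fromFin-toFin 0# = refl
  fromFin-toFin 1# = refl
  fromFin-toFin ω  = refl
  fromFin-toFin ω̄  = refl

  toFin-injective : ∀ c d → toFin c ≡ toFin d → c ≡ d
  toFin-injective c d eq =
    subst (_≡ d) (fromFin-toFin c) (subst (λ i → fromFin i ≡ d) (sym eq) (fromFin-toFin d))

∀𝔽₄? : ∀ {p} {P : Pred 𝔽₄ p} → Decidable P → Dec (∀ a → P a)
∀𝔽₄? P? = map′ (λ { (p , q , r , s) → λ { 0# → p ; 1# → q ; ω → r ; ω̄ → s } })
               (λ f → f 0# , f 1# , f ω , f ω̄)
               (P? 0# ×-dec P? 1# ×-dec P? ω ×-dec P? ω̄)

𝔽₄-isCommutativeRing : IsCommutativeRing _≡_ _+_ _*_ -_ 0# 1#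
𝔽₄-isCommutativeRing = record
  { isRing = record
    { +-isAbelianGroup = record
      { isGroup = record
        { isMonoid = record
          { isSemigroup = record
            { isMagma = record { isEquivalence = isEquivalence ; ∙-cong = cong₂ _+_ }
            ; assoc = from-yes (∀𝔽₄? λ a → ∀𝔽₄? λ b → ∀𝔽₄? λ c → (a + b) + c ≟ a + (b + c))
            }
          ; identity = from-yes (∀𝔽₄? λ a → 0# + a ≟ a) , from-yes (∀𝔽₄? λ a → a + 0# ≟ a)
          }
        ; inverse = from-yes (∀𝔽₄? λ a → - a + a ≟ 0#) , from-yes (∀𝔽₄? λ a → a + - a ≟ 0#)
        ; ⁻¹-cong = cong -_
        }
      ; comm = from-yes (∀𝔽₄? λ a → ∀𝔽₄? λ b → a + b ≟ b + a)
      }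
    ; *-cong = cong₂ _*_
    ; *-assoc = from-yes (∀𝔽₄? λ a → ∀𝔽₄? λ b → ∀𝔽₄? λ c → (a * b) * c ≟ a * (b * c))
    ; *-identity = from-yes (∀𝔽₄? λ a → 1# * a ≟ a) , from-yes (∀𝔽₄? λ a → a * 1# ≟ a)
    ; distrib = from-yes (∀𝔽₄? λ a → ∀𝔽₄? λ b → ∀𝔽₄? λ c → a * (b + c) ≟ a * b + a * c)
              , from-yes (∀𝔽₄? λ a → ∀𝔽₄? λ b → ∀𝔽₄? λ c → (b + c) * a ≟ b * a + c * a)
    }
  ; *-comm = from-yes (∀𝔽₄? λ a → ∀𝔽₄? λ b → a * b ≟ b * a)
  }

𝔽₄-commutativeRing : CommutativeRing 0ℓ 0ℓ
𝔽₄-commutativeRing = record { isCommutativeRing = 𝔽₄-isCommutativeRing }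

*-invertible : ∀ a → a ≢ 0# → ∃[ b ] a * b ≡ 1#
*-invertible 0# a≢0 with () ← a≢0 refl
*-invertible 1# _ = 1# , refl
*-invertible ω  _ = ω̄ , refl
*-invertible ω̄  _ = ω , refl

open SemiringSum (CommutativeRing.semiring 𝔽₄-commutativeRing) public using (sum; sum-syntax)
open SemiringExp (CommutativeRing.semiring 𝔽₄-commutativeRing) public using (_^_)

-- Polynomials of degree less than 4 (in each variable) as arrays of
-- coefficients: h is Σᵢ (coeff₁ h i) xⁱ and f is Σᵢⱼ (coeff₂ f i j) xⁱ yʲ.

Poly₁ : Set
Poly₁ = Vec 𝔽₄ 4

Poly₂ : Set
Poly₂ = Vec (Vec 𝔽₄ 4) 4

coeff₁ : Poly₁ → Fin 4 → 𝔽₄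
coeff₁ h i = lookup h i

coeff₂ : Poly₂ → Fin 4 → Fin 4 → 𝔽₄
coeff₂ f i j = lookup (lookup f i) j

eval₁ : Poly₁ → 𝔽₄ → 𝔽₄
eval₁ h a = ∑[ i < 4 ] (coeff₁ h i * a ^ toℕ i)

eval₂ : Poly₂ → 𝔽₄ → 𝔽₄ → 𝔽₄
eval₂ f a b = ∑[ i < 4 ] (∑[ j < 4 ] (coeff₂ f i j * (a ^ toℕ i * b ^ toℕ j)))

HasTotalDegree : Poly₂ → ℕ → Set
HasTotalDegree f d =
  (∃[ i ] ∃[ j ] coeff₂ f i j ≢ 0# × toℕ i ℕ.+ toℕ j ≡ d) ×
  (∀ i j → coeff₂ f i j ≢ 0# → toℕ i ℕ.+ toℕ j ≤ d)

-- Polynomials of 𝔽₄[x,y] of arbitrary degree, as finite formal sums of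
-- terms; term c m n is c xᵐ yⁿ.  Exponents may repeat and coefficients may
-- vanish, so these lists are only ever compared after reduction.

record Term : Set where
  constructor term
  field
    coefficient : 𝔽₄
    xExponent   : ℕ
    yExponent   : ℕ

open Term public

Poly : Set
Poly = List Term

const : 𝔽₄ → Poly
const c = term c 0 0 ∷ []

X Y : Poly
X = term 1# 1 0 ∷ []
Y = term 1# 0 1 ∷ []

infixl 6 _⊕_
infixl 7 _⊗_
infixr 8 _^ᴾ_

_⊕_ : Poly → Poly → Poly
_⊕_ = _++_

_⊗_ : Poly → Poly → Poly
_⊗_ = cartesianProductWith λ (term c m n) (term d k l) → term (c * d) (m ℕ.+ k) (n ℕ.+ l)

_^ᴾ_ : Poly → ℕ → Poly
p ^ᴾ zero  = const 1#
p ^ᴾ suc n = p ⊗ p ^ᴾ n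

⨁ : (Fin 4 → Poly) → Poly
⨁ s = foldr (λ i p → s i ⊕ p) [] (allFin 4)

-- h(p) and f(p,q), expanded in 𝔽₄[x,y].

_[_]₁ : Poly₁ → Poly → Poly
h [ p ]₁ = ⨁ λ i → const (coeff₁ h i) ⊗ p ^ᴾ toℕ i

_[_,_]₂ : Poly₂ → Poly → Poly → Poly
f [ p , q ]₂ = ⨁ λ i → ⨁ λ j → const (coeff₂ f i j) ⊗ (p ^ᴾ toℕ i ⊗ q ^ᴾ toℕ j)

-- The exponent of the remainder of xⁿ modulo x⁴ - x.
reduceExponent : ℕ → Fin 4
reduceExponent zero    = zero
reduceExponent (suc n) = suc (n mod 3)

-- The remainder modulo x⁴ - x and y⁴ - y.
reduce : Poly → Poly₂
reduce p = tabulate λ i → tabulate λ j →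
  foldr _+_ 0# (map coefficient (filter (reducesTo? i j) p))
  where
  reducesTo? : ∀ i j (t : Term) →
    Dec (reduceExponent (xExponent t) ≡ i × reduceExponent (yExponent t) ≡ j)
  reducesTo? i j t =
    reduceExponent (xExponent t) ≟ᶠ i ×-dec reduceExponent (yExponent t) ≟ᶠ j

IsPermutation : (𝔽₄ → 𝔽₄) → Set
IsPermutation = Bijective _≡_ _≡_

𝒫₄ : Pred Poly₁ 0ℓ
𝒫₄ h = IsPermutation (eval₁ h)

ℒ𝒫₄ : Pred Poly₂ 0ℓ
ℒ𝒫₄ f = ∀ a → IsPermutation (λ x → eval₂ f x a) × IsPermutation (λ x → eval₂ f a x)

ℒ𝒫₄[_] : ℕ → Pred Poly₂ 0ℓ
ℒ𝒫₄[ d ] f = ℒ𝒫₄ f × HasTotalDegree f d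

IsotopicTo : Poly₂ → Poly₂ → Set
IsotopicTo f g = ∃[ h₁ ] ∃[ h₂ ] ∃[ h₃ ] 𝒫₄ h₁ × 𝒫₄ h₂ × 𝒫₄ h₃ ×
  reduce (g [ h₁ [ X ]₁ , h₂ [ Y ]₁ ]₂) ≡ reduce (h₃ [ f [ X , Y ]₂ ]₁)

isotopismClass : Poly₂ → Pred Poly₂ 0ℓ
isotopismClass f g = ℒ𝒫₄ g × IsotopicTo f g

IsIsotopismClass : Pred Poly₂ 0ℓ → Set
IsIsotopismClass C = ∃[ f ] ℒ𝒫₄ f × C ≐ isotopismClass f

{-# OPTIONS --safe #-}
-- A polynomial of degree less than 4 in each variable is the same as a function,
-- so isotopism of polynomials is isotopism of the Latin squares they define.
-- Permuting symbols and columns turns any Latin square into one whose first row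
-- and column are in order, and of these there are only four: the addition of 𝔽₄
-- and, for each v ≠ 0, the cyclic group a + b + a(a + v)b(b + v), all three being
-- isotopic by scaling.  The two types are told apart by the quadrangle criterion.
-- The degrees are found by running through the squares ℓ(R(a, μ(b))), with R one of
-- those four and ℓ, μ permutations with μ(0) = 0.
module Submission where

open import Defs
open import Algebra.Bundles using (CommutativeRing)
import Algebra.Properties.CommutativeSemigroup as CommutativeSemigroupProperties
import Algebra.Properties.Semiring.Exp as SemiringExp
import Algebra.Properties.Semiring.Sum as SemiringSum
open import Data.Bool.Base using (if_then_else_; true; false; _∧_)
open import Data.Fin.Base using (Fin; zero; suc; toℕ)
open import Data.Fin.Properties using (all?; any?) renaming (_≟_ to _≟ᶠ_)
open import Data.List.Base using ([]; _∷_; filter; foldr; map)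
open import Data.Nat.Base as ℕ using (zero; suc)
import Data.Nat.Properties as ℕ
open import Data.Product.Base using (∃; ∃-syntax; Σ-syntax; _×_; _,_; proj₁; proj₂)
open import Data.Sum.Base as Sum using (_⊎_; inj₁; inj₂)
open import Data.Vec.Base using (Vec; []; _∷_; lookup; tabulate)
open import Data.Vec.Properties using (lookup∘tabulate; tabulate∘lookup; tabulate-cong; ≡-dec)
open import Function.Base using (_∘_; _$_)
open import Function.Bundles using (_↔_; module Inverse; module Bijection; mk⤖)
open import Function.Consequences.Propositional using (strictlySurjective⇒surjective)
open import Function.Definitions using (Injective)
open import Function.Properties.Bijection using (⤖⇒↔)
open import Function.Properties.Inverse using (↔-refl; ↔-sym; ↔-trans; ↔⇒⤖)
open import Level using (0ℓ)
open import Relation.Binary.PropositionalEquality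
open import Relation.Nullary.Decidable hiding (map)
open import Relation.Nullary.Negation using (¬_; contradiction)
open import Relation.Unary using (Pred; Decidable; _∪_; _≐_; _⊥_)
open import Relation.Unary.Properties using (≐-sym; ≐-trans)

open CommutativeRing 𝔽₄-commutativeRing
  using (+-assoc; +-identityˡ; zeroʳ; distribˡ; distribʳ; semiring; *-commutativeSemigroup)
open CommutativeSemigroupProperties *-commutativeSemigroup using (interchange; x∙yz≈xz∙y)
open SemiringSum semiring using (sum-cong-≗; ∑-distrib-+; *-distribʳ-sum)
open SemiringExp semiring using (^-homo-*)
open ≡-Reasoning

-- Finite search over 𝔽₄, and its permutations

∃𝔽₄? : ∀ {p} {P : Pred 𝔽₄ p} → Decidable P → Dec (∃ P)
∃𝔽₄? P? = map′
  (λ { (inj₁ p) → 0# , p ; (inj₂ (inj₁ p)) → 1# , p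
     ; (inj₂ (inj₂ (inj₁ p))) → ω , p ; (inj₂ (inj₂ (inj₂ p))) → ω̄ , p })
  (λ { (0# , p) → inj₁ p ; (1# , p) → inj₂ (inj₁ p)
     ; (ω , p) → inj₂ (inj₂ (inj₁ p)) ; (ω̄ , p) → inj₂ (inj₂ (inj₂ p)) })
  (P? 0# ⊎-dec P? 1# ⊎-dec P? ω ⊎-dec P? ω̄)

∀Vec? : ∀ {p n} {P : Pred (Vec 𝔽₄ n) p} → Decidable P → Dec (∀ v → P v)
∀Vec? {n = zero}  P? = map′ (λ { p [] → p }) (_$ []) (P? [])
∀Vec? {n = suc n} P? = map′ (λ { p (a ∷ v) → p a v }) (λ p a v → p (a ∷ v))
  (∀𝔽₄? λ a → ∀Vec? λ v → P? (a ∷ v))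

Injective? : (u : 𝔽₄ → 𝔽₄) → Dec (Injective _≡_ _≡_ u)
Injective? u = map′ (λ p {a} {b} → p a b) (λ p a b → p {a} {b})
  (∀𝔽₄? λ a → ∀𝔽₄? λ b → (u a ≟ u b) →-dec (a ≟ b))

-- Without function extensionality the maps 𝔽₄ → 𝔽₄ cannot be enumerated, but
-- their tables of values can.

table : (𝔽₄ → 𝔽₄) → Vec 𝔽₄ 4
table u = u 0# ∷ u 1# ∷ u ω ∷ u ω̄ ∷ []

⟦_⟧ : Vec 𝔽₄ 4 → 𝔽₄ → 𝔽₄
⟦ p ∷ q ∷ r ∷ s ∷ [] ⟧ = λ { 0# → p ; 1# → q ; ω → r ; ω̄ → s }

⟦table⟧ : ∀ u → ⟦ table u ⟧ ≗ u
⟦table⟧ u 0# = refl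
⟦table⟧ u 1# = refl
⟦table⟧ u ω  = refl
⟦table⟧ u ω̄  = refl

Injective-resp-≗ : ∀ {u w : 𝔽₄ → 𝔽₄} → u ≗ w → Injective _≡_ _≡_ u → Injective _≡_ _≡_ w
Injective-resp-≗ u≗w inj {a} {b} eq = inj (trans (u≗w a) (trans eq (sym (u≗w b))))

⟦table⟧-injective : ∀ {u} → Injective _≡_ _≡_ u → Injective _≡_ _≡_ ⟦ table u ⟧
⟦table⟧-injective {u} = Injective-resp-≗ (sym ∘ ⟦table⟧ u)

opaque
  -- Pigeonhole on four elements, checked on all 256 tables of values.
  ⟦⟧-injective⇒surjective : ∀ t → Injective _≡_ _≡_ ⟦ t ⟧ → ∀ b → ∃[ a ] ⟦ t ⟧ a ≡ b
  ⟦⟧-injective⇒surjective = from-yes (∀Vec? λ t → Injective? ⟦ t ⟧ →-dec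
    ∀𝔽₄? λ b → ∃𝔽₄? λ a → ⟦ t ⟧ a ≟ b)

injective⇒permutation : ∀ {u} → Injective _≡_ _≡_ u → IsPermutation u
injective⇒permutation {u} inj = inj , strictlySurjective⇒surjective λ b →
  let a , eq = ⟦⟧-injective⇒surjective (table u) (⟦table⟧-injective inj) b
  in a , trans (sym (⟦table⟧ u a)) eq

permutation : ∀ {u} → Injective _≡_ _≡_ u → 𝔽₄ ↔ 𝔽₄
permutation inj = ⤖⇒↔ (mk⤖ (injective⇒permutation inj))

open Inverse using (to; from)

to-injective : ∀ (σ : 𝔽₄ ↔ 𝔽₄) → Injective _≡_ _≡_ (to σ)
to-injective σ = Bijection.injective (↔⇒⤖ σ)

-- Interpolation

-- For k < 6 the sum Σₐ aᵏ (with 0⁰ = 1) is 1 if k = 3 and 0 otherwise, so the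
-- coefficient of xⁱ is Σₐ a³⁻ⁱ u(a) for i ≥ 1.
interp₁ : (𝔽₄ → 𝔽₄) → Poly₁
interp₁ u = u 0#
          ∷ u 1# + ω̄ * u ω + ω * u ω̄
          ∷ u 1# + ω * u ω + ω̄ * u ω̄
          ∷ u 0# + u 1# + u ω + u ω̄
          ∷ []

eval₁-interp₁-⟦⟧ : ∀ t → eval₁ (interp₁ ⟦ t ⟧) ≗ ⟦ t ⟧
eval₁-interp₁-⟦⟧ = from-yes (∀Vec? λ t → ∀𝔽₄? λ a → eval₁ (interp₁ ⟦ t ⟧) a ≟ ⟦ t ⟧ a)

eval₁-interp₁ : ∀ u → eval₁ (interp₁ u) ≗ u
eval₁-interp₁ u a = trans (eval₁-interp₁-⟦⟧ (table u) a) (⟦table⟧ u a)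

interp₁-eval₁ : ∀ h → interp₁ (eval₁ h) ≡ h
interp₁-eval₁ = from-yes (∀Vec? λ h → ≡-dec _≟_ (interp₁ (eval₁ h)) h)

interp₁-cong : ∀ {u w} → u ≗ w → interp₁ u ≡ interp₁ w
interp₁-cong u≗w rewrite u≗w 0# | u≗w 1# | u≗w ω | u≗w ω̄ = refl

eval₁-injective : ∀ {h k} → eval₁ h ≗ eval₁ k → h ≡ k
eval₁-injective {h} {k} eq =
  trans (sym (interp₁-eval₁ h)) (trans (interp₁-cong eq) (interp₁-eval₁ k))

infix 9 _[-,_]

-- Specialising y to b leaves a polynomial in x, which reduces two variables to one.
_[-,_] : Poly₂ → 𝔽₄ → Poly₁
f [-, b ] = tabulate λ i → eval₁ (lookup f i) b

eval₂≡eval₁ : ∀ f a b → eval₂ f a b ≡ eval₁ (f [-, b ]) a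
eval₂≡eval₁ f a b = sum-cong-≗ {4} λ i → begin
  ∑[ j < 4 ] (coeff₂ f i j * (a ^ toℕ i * b ^ toℕ j))
    ≡⟨ sum-cong-≗ {4} (λ j → x∙yz≈xz∙y (coeff₂ f i j) (a ^ toℕ i) (b ^ toℕ j)) ⟩
  ∑[ j < 4 ] (coeff₂ f i j * b ^ toℕ j * a ^ toℕ i)
    ≡⟨ *-distribʳ-sum {4} (a ^ toℕ i) (λ j → coeff₂ f i j * b ^ toℕ j) ⟨
  eval₁ (lookup f i) b * a ^ toℕ i
    ≡⟨ cong (_* a ^ toℕ i) (lookup∘tabulate (λ k → eval₁ (lookup f k) b) i) ⟨
  lookup (f [-, b ]) i * a ^ toℕ i ∎

lookup-ext : ∀ {A : Set} {n} {v w : Vec A n} → lookup v ≗ lookup w → v ≡ w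
lookup-ext {v = v} {w} eq =
  trans (sym (tabulate∘lookup v)) (trans (tabulate-cong eq) (tabulate∘lookup w))

-- `eval₁-injective` is used twice: in x for each fixed b, which identifies the values at b of all
-- rows of coefficients, and then in y for each row.
eval₂-injective : ∀ {f g} → (∀ a b → eval₂ f a b ≡ eval₂ g a b) → f ≡ g
eval₂-injective {f} {g} eq = lookup-ext λ i → eval₁-injective λ b → begin
  eval₁ (lookup f i) b ≡⟨ lookup∘tabulate (λ k → eval₁ (lookup f k) b) i ⟨
  lookup (f [-, b ]) i ≡⟨ cong (λ h → lookup h i) (eval₁-injective {f [-, b ]} {g [-, b ]} λ a →
                            trans (sym (eval₂≡eval₁ f a b)) (trans (eq a b) (eval₂≡eval₁ g a b))) ⟩
  lookup (g [-, b ]) i ≡⟨ lookup∘tabulate (λ k → eval₁ (lookup g k) b) i ⟩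
  eval₁ (lookup g i) b ∎

interp₂ : (𝔽₄ → 𝔽₄ → 𝔽₄) → Poly₂
interp₂ F = tabulate λ i → interp₁ λ b → lookup (interp₁ λ a → F a b) i

-- Specialising at b undoes the interpolation in y, coefficient by coefficient; evaluating at a then
-- undoes the one in x.
eval₂-interp₂ : ∀ F a b → eval₂ (interp₂ F) a b ≡ F a b
eval₂-interp₂ F a b = begin
  eval₂ (interp₂ F) a b         ≡⟨ eval₂≡eval₁ (interp₂ F) a b ⟩
  eval₁ (interp₂ F [-, b ]) a   ≡⟨ cong (λ h → eval₁ h a) column ⟩
  eval₁ (interp₁ λ a → F a b) a ≡⟨ eval₁-interp₁ (λ a → F a b) a ⟩
  F a b                         ∎
  where
  row : Fin 4 → 𝔽₄ → 𝔽₄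
  row i b = lookup (interp₁ λ a → F a b) i

  column : interp₂ F [-, b ] ≡ interp₁ λ a → F a b
  column = lookup-ext λ i → begin
    lookup (interp₂ F [-, b ]) i
      ≡⟨ lookup∘tabulate (λ i → eval₁ (lookup (interp₂ F) i) b) i ⟩
    eval₁ (lookup (interp₂ F) i) b
      ≡⟨ cong (λ h → eval₁ h b) (lookup∘tabulate (λ i → interp₁ (row i)) i) ⟩
    eval₁ (interp₁ (row i)) b
      ≡⟨ eval₁-interp₁ (row i) b ⟩
    row i b ∎

-- Evaluation of formal sums of terms

evalᴾ : Poly → 𝔽₄ → 𝔽₄ → 𝔽₄
evalᴾ []                 a b = 0#
evalᴾ (term c m n ∷ p) a b = c * (a ^ m * b ^ n) + evalᴾ p a b

module _ (a b : 𝔽₄) where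

  evalᴾ-⊕ : ∀ p q → evalᴾ (p ⊕ q) a b ≡ evalᴾ p a b + evalᴾ q a b
  evalᴾ-⊕ []                 q = sym (+-identityˡ _)
  evalᴾ-⊕ (term c m n ∷ p) q =
    trans (cong (c * (a ^ m * b ^ n) +_) (evalᴾ-⊕ p q)) (sym (+-assoc (c * (a ^ m * b ^ n)) _ _))

  -- The list on the left is the share of `_⊗_` that comes from a single term of its left factor.
  evalᴾ-term⊗ : ∀ c m n q →
    evalᴾ (map (λ (term d k l) → term (c * d) (m ℕ.+ k) (n ℕ.+ l)) q) a b
      ≡ c * (a ^ m * b ^ n) * evalᴾ q a b
  evalᴾ-term⊗ c m n []               = sym (zeroʳ _)
  evalᴾ-term⊗ c m n (term d k l ∷ q) = begin
    c * d * (a ^ (m ℕ.+ k) * b ^ (n ℕ.+ l)) + evalᴾ (map _ q) a b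
      ≡⟨ cong₂ _+_ (begin
           c * d * (a ^ (m ℕ.+ k) * b ^ (n ℕ.+ l))
             ≡⟨ cong (c * d *_) (cong₂ _*_ (^-homo-* a m k) (^-homo-* b n l)) ⟩
           c * d * (a ^ m * a ^ k * (b ^ n * b ^ l))
             ≡⟨ cong (c * d *_) (interchange (a ^ m) (a ^ k) (b ^ n) (b ^ l)) ⟩
           c * d * (a ^ m * b ^ n * (a ^ k * b ^ l))
             ≡⟨ interchange c d (a ^ m * b ^ n) (a ^ k * b ^ l) ⟩
           c * (a ^ m * b ^ n) * (d * (a ^ k * b ^ l)) ∎)
         (evalᴾ-term⊗ c m n q) ⟩
    c * (a ^ m * b ^ n) * (d * (a ^ k * b ^ l)) + c * (a ^ m * b ^ n) * evalᴾ q a b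
      ≡⟨ distribˡ (c * (a ^ m * b ^ n)) _ _ ⟨
    c * (a ^ m * b ^ n) * (d * (a ^ k * b ^ l) + evalᴾ q a b) ∎

  evalᴾ-⊗ : ∀ p q → evalᴾ (p ⊗ q) a b ≡ evalᴾ p a b * evalᴾ q a b
  evalᴾ-⊗ []               q = refl
  evalᴾ-⊗ (term c m n ∷ p) q = begin
    evalᴾ (map _ q ⊕ p ⊗ q) a b
      ≡⟨ evalᴾ-⊕ (map _ q) (p ⊗ q) ⟩
    evalᴾ (map _ q) a b + evalᴾ (p ⊗ q) a b
      ≡⟨ cong₂ _+_ (evalᴾ-term⊗ c m n q) (evalᴾ-⊗ p q) ⟩
    c * (a ^ m * b ^ n) * evalᴾ q a b + evalᴾ p a b * evalᴾ q a b
      ≡⟨ distribʳ (evalᴾ q a b) (c * (a ^ m * b ^ n)) _ ⟨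
    (c * (a ^ m * b ^ n) + evalᴾ p a b) * evalᴾ q a b ∎

  evalᴾ-const : ∀ c → evalᴾ (const c) a b ≡ c
  evalᴾ-const = from-yes (∀𝔽₄? λ c → c * (1# * 1#) + 0# ≟ c)

  evalᴾ-^ : ∀ p n → evalᴾ (p ^ᴾ n) a b ≡ evalᴾ p a b ^ n
  evalᴾ-^ p zero    = refl
  evalᴾ-^ p (suc n) = trans (evalᴾ-⊗ p (p ^ᴾ n)) (cong (evalᴾ p a b *_) (evalᴾ-^ p n))

  evalᴾ-⨁ : ∀ (s : Fin 4 → Poly) → evalᴾ (⨁ s) a b ≡ ∑[ i < 4 ] evalᴾ (s i) a b
  evalᴾ-⨁ s =
    trans (evalᴾ-⊕ (s zero) _) $ cong (evalᴾ (s zero) a b +_) $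
    trans (evalᴾ-⊕ (s (suc zero)) _) $ cong (evalᴾ (s (suc zero)) a b +_) $
    trans (evalᴾ-⊕ (s (suc (suc zero))) _) $ cong (evalᴾ (s (suc (suc zero))) a b +_) $
    evalᴾ-⊕ (s (suc (suc (suc zero)))) []

  -- By the lemmas above evaluation respects sums, products and powers, hence substitution.
  evalᴾ-[]₁ : ∀ h p → evalᴾ (h [ p ]₁) a b ≡ eval₁ h (evalᴾ p a b)
  evalᴾ-[]₁ h p = trans (evalᴾ-⨁ s) $ sum-cong-≗ {4} λ i →
    trans (evalᴾ-⊗ (const (coeff₁ h i)) (p ^ᴾ toℕ i))
          (cong₂ _*_ (evalᴾ-const (coeff₁ h i)) (evalᴾ-^ p (toℕ i)))
    where
    s : Fin 4 → Poly
    s i = const (coeff₁ h i) ⊗ p ^ᴾ toℕ i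

  evalᴾ-[]₂ : ∀ f p q → evalᴾ (f [ p , q ]₂) a b ≡ eval₂ f (evalᴾ p a b) (evalᴾ q a b)
  evalᴾ-[]₂ f p q = trans (evalᴾ-⨁ (⨁ ∘ s)) $ sum-cong-≗ {4} λ i →
    trans (evalᴾ-⨁ (s i)) $ sum-cong-≗ {4} λ j →
    trans (evalᴾ-⊗ (const (coeff₂ f i j)) (p ^ᴾ toℕ i ⊗ q ^ᴾ toℕ j)) $
    cong₂ _*_ (evalᴾ-const (coeff₂ f i j)) $
    trans (evalᴾ-⊗ (p ^ᴾ toℕ i) (q ^ᴾ toℕ j)) (cong₂ _*_ (evalᴾ-^ p (toℕ i)) (evalᴾ-^ q (toℕ j)))
    where
    s : Fin 4 → Fin 4 → Poly
    s i j = const (coeff₂ f i j) ⊗ (p ^ᴾ toℕ i ⊗ q ^ᴾ toℕ j)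

evalᴾ-X : ∀ a b → evalᴾ X a b ≡ a
evalᴾ-X = from-yes (∀𝔽₄? λ a → ∀𝔽₄? λ b → evalᴾ X a b ≟ a)

evalᴾ-Y : ∀ a b → evalᴾ Y a b ≡ b
evalᴾ-Y = from-yes (∀𝔽₄? λ a → ∀𝔽₄? λ b → evalᴾ Y a b ≟ b)

evalᴾ-composite₁ : ∀ h f a b → evalᴾ (h [ f [ X , Y ]₂ ]₁) a b ≡ eval₁ h (eval₂ f a b)
evalᴾ-composite₁ h f a b = trans (evalᴾ-[]₁ a b h (f [ X , Y ]₂)) $ cong (eval₁ h) $
  trans (evalᴾ-[]₂ a b f X Y) (cong₂ (eval₂ f) (evalᴾ-X a b) (evalᴾ-Y a b))

evalᴾ-composite₂ : ∀ g h k a b →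
  evalᴾ (g [ h [ X ]₁ , k [ Y ]₁ ]₂) a b ≡ eval₂ g (eval₁ h a) (eval₁ k b)
evalᴾ-composite₂ g h k a b = trans (evalᴾ-[]₂ a b g (h [ X ]₁) (k [ Y ]₁)) $ cong₂ (eval₂ g)
  (trans (evalᴾ-[]₁ a b h X) (cong (eval₁ h) (evalᴾ-X a b)))
  (trans (evalᴾ-[]₁ a b k Y) (cong (eval₁ k) (evalᴾ-Y a b)))

-- n mod 3 and (3 + n) mod 3 are definitionally equal.
^-reduceExponent : ∀ a n → a ^ toℕ (reduceExponent n) ≡ a ^ n
^-reduceExponent a 0 = refl
^-reduceExponent a 1 = refl
^-reduceExponent a 2 = refl
^-reduceExponent a 3 = refl
^-reduceExponent a (suc (suc (suc (suc n)))) =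
  trans (^-reduceExponent a (suc n)) (a^4≡a a (a ^ n))
  where
  a^4≡a : ∀ a b → a * b ≡ a * (a * (a * (a * b)))
  a^4≡a = from-yes (∀𝔽₄? λ a → ∀𝔽₄? λ b → a * b ≟ a * (a * (a * (a * b))))

-- The coefficients of a single monomial. The boolean conjunction is what the test in `reduce`
-- computes to, so one case split in `coeff₂-reduce-∷` settles both sides.
δ : Fin 4 → Fin 4 → 𝔽₄ → Fin 4 → Fin 4 → 𝔽₄
δ k l c i j = if does (k ≟ᶠ i) ∧ does (l ≟ᶠ j) then c else 0#

sum-δ : ∀ k l c a b →
  ∑[ i < 4 ] (∑[ j < 4 ] (δ k l c i j * (a ^ toℕ i * b ^ toℕ j))) ≡ c * (a ^ toℕ k * b ^ toℕ l)
sum-δ = from-yes (all? λ k → all? λ l → ∀𝔽₄? λ c → ∀𝔽₄? λ a → ∀𝔽₄? λ b →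
  ∑[ i < 4 ] (∑[ j < 4 ] (δ k l c i j * (a ^ toℕ i * b ^ toℕ j))) ≟ c * (a ^ toℕ k * b ^ toℕ l))

lookup²∘tabulate² : ∀ {A : Set} {m n} (u : Fin m → Fin n → A) i j →
  lookup (lookup (tabulate λ i → tabulate (u i)) i) j ≡ u i j
lookup²∘tabulate² u i j = trans
  (cong (λ v → lookup v j) (lookup∘tabulate (λ i → tabulate (u i)) i))
  (lookup∘tabulate (u i) j)

coeff₂-reduce : ∀ p i j → coeff₂ (reduce p) i j ≡
  foldr _+_ 0# (map coefficient (filter (λ t →
    reduceExponent (xExponent t) ≟ᶠ i ×-dec reduceExponent (yExponent t) ≟ᶠ j) p))
coeff₂-reduce p = lookup²∘tabulate² λ i j →
  foldr _+_ 0# (map coefficient (filter (λ t →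
    reduceExponent (xExponent t) ≟ᶠ i ×-dec reduceExponent (yExponent t) ≟ᶠ j) p))

coeff₂-reduce-∷ : ∀ c m n p i j →
  coeff₂ (reduce (term c m n ∷ p)) i j
    ≡ δ (reduceExponent m) (reduceExponent n) c i j + coeff₂ (reduce p) i j
coeff₂-reduce-∷ c m n p i j rewrite coeff₂-reduce (term c m n ∷ p) i j | coeff₂-reduce p i j
  with does (reduceExponent m ≟ᶠ i) | does (reduceExponent n ≟ᶠ j)
... | true  | true  = refl
... | true  | false = sym (+-identityˡ _)
... | false | _     = sym (+-identityˡ _)

-- Reduction keeps values because a⁴ = a on 𝔽₄. Each term of the list adds one array `δ` to the
-- coefficients, so the induction comes down to the value of one reduced monomial.
eval₂-reduce : ∀ p a b → eval₂ (reduce p) a b ≡ evalᴾ p a b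
eval₂-reduce [] = from-yes (∀𝔽₄? λ a → ∀𝔽₄? λ b → eval₂ (reduce []) a b ≟ 0#)
eval₂-reduce (term c m n ∷ p) a b = begin
  ∑[ i < 4 ] (∑[ j < 4 ] (coeff₂ (reduce (term c m n ∷ p)) i j * x i j))
    ≡⟨ (sum-cong-≗ {4} λ i → sum-cong-≗ {4} λ j →
        trans (cong (_* x i j) (coeff₂-reduce-∷ c m n p i j)) (distribʳ (x i j) (d i j) _)) ⟩
  ∑[ i < 4 ] (∑[ j < 4 ] (d i j * x i j + r i j * x i j))
    ≡⟨ (sum-cong-≗ {4} λ i → ∑-distrib-+ {4} (λ j → d i j * x i j) (λ j → r i j * x i j)) ⟩
  ∑[ i < 4 ] (∑[ j < 4 ] (d i j * x i j) + ∑[ j < 4 ] (r i j * x i j))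
    ≡⟨ ∑-distrib-+ {4} (λ i → ∑[ j < 4 ] (d i j * x i j)) (λ i → ∑[ j < 4 ] (r i j * x i j)) ⟩
  ∑[ i < 4 ] (∑[ j < 4 ] (d i j * x i j)) + eval₂ (reduce p) a b
    ≡⟨ cong₂ _+_ (sum-δ (reduceExponent m) (reduceExponent n) c a b) (eval₂-reduce p a b) ⟩
  c * (a ^ toℕ (reduceExponent m) * b ^ toℕ (reduceExponent n)) + evalᴾ p a b
    ≡⟨ cong (λ y → c * y + evalᴾ p a b) (cong₂ _*_ (^-reduceExponent a m) (^-reduceExponent b n)) ⟩
  c * (a ^ m * b ^ n) + evalᴾ p a b ∎
  where
  x d r : Fin 4 → Fin 4 → 𝔽₄
  x i j = a ^ toℕ i * b ^ toℕ j
  d = δ (reduceExponent m) (reduceExponent n) c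
  r = coeff₂ (reduce p)

-- Latin squares and isotopy

-- Injectivity is enough for permutations of a finite set, by `injective⇒permutation`.
Latin : (𝔽₄ → 𝔽₄ → 𝔽₄) → Set
Latin F = (∀ b → Injective _≡_ _≡_ λ a → F a b) × (∀ a → Injective _≡_ _≡_ (F a))

ℒ𝒫₄⇒Latin : ∀ {f} → ℒ𝒫₄ f → Latin (eval₂ f)
ℒ𝒫₄⇒Latin p = (λ b → proj₁ (proj₁ (p b))) , (λ a → proj₁ (proj₂ (p a)))

Latin⇒ℒ𝒫₄ : ∀ {f} → Latin (eval₂ f) → ℒ𝒫₄ f
Latin⇒ℒ𝒫₄ (p , q) a = injective⇒permutation (p a) , injective⇒permutation (q a)

Latin-resp : ∀ {F G} → (∀ a b → F a b ≡ G a b) → Latin F → Latin G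
Latin-resp eq (p , q) =
  (λ b → Injective-resp-≗ (λ a → eq a b) (p b)) , (λ a → Injective-resp-≗ (eq a) (q a))

-- Bijections replace the permutation polynomials, so that inverses and composites are available
-- without interpolating.
record Isotopic (F G : 𝔽₄ → 𝔽₄ → 𝔽₄) : Set where
  constructor isotopy
  field
    rows columns symbols : 𝔽₄ ↔ 𝔽₄
    intertwines : ∀ a b → G (to rows a) (to columns b) ≡ to symbols (F a b)

Isotopic-reflexive : ∀ {F G} → (∀ a b → F a b ≡ G a b) → Isotopic F G
Isotopic-reflexive eq = isotopy ↔-refl ↔-refl ↔-refl λ a b → sym (eq a b)

Isotopic-sym : ∀ {F G} → Isotopic F G → Isotopic G F
Isotopic-sym {F} {G} (isotopy σ τ ρ eq) = isotopy (↔-sym σ) (↔-sym τ) (↔-sym ρ) λ a b → begin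
  F (from σ a) (from τ b)                         ≡⟨ strictlyInverseʳ ρ _ ⟨
  from ρ (to ρ (F (from σ a) (from τ b)))         ≡⟨ cong (from ρ) (eq _ _) ⟨
  from ρ (G (to σ (from σ a)) (to τ (from τ b)))
    ≡⟨ cong (from ρ) (cong₂ G (strictlyInverseˡ σ a) (strictlyInverseˡ τ b)) ⟩
  from ρ (G a b)                                  ∎
  where open Inverse

Isotopic-trans : ∀ {F G H} → Isotopic F G → Isotopic G H → Isotopic F H
Isotopic-trans (isotopy σ τ ρ eq) (isotopy σ′ τ′ ρ′ eq′) =
  isotopy (↔-trans σ σ′) (↔-trans τ τ′) (↔-trans ρ ρ′)
  λ a b → trans (eq′ (to σ a) (to τ b)) (cong (to ρ′) (eq a b))

-- With its converse below, this turns equality modulo x⁴ - x and y⁴ - y into equality of functions.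
reduce-≡⇒evalᴾ-≡ : ∀ p q → reduce p ≡ reduce q → ∀ a b → evalᴾ p a b ≡ evalᴾ q a b
reduce-≡⇒evalᴾ-≡ p q eq a b = begin
  evalᴾ p a b          ≡⟨ eval₂-reduce p a b ⟨
  eval₂ (reduce p) a b ≡⟨ cong (λ f → eval₂ f a b) eq ⟩
  eval₂ (reduce q) a b ≡⟨ eval₂-reduce q a b ⟩
  evalᴾ q a b          ∎

evalᴾ-≡⇒reduce-≡ : ∀ p q → (∀ a b → evalᴾ p a b ≡ evalᴾ q a b) → reduce p ≡ reduce q
evalᴾ-≡⇒reduce-≡ p q eq = eval₂-injective {reduce p} {reduce q} λ a b →
  trans (eval₂-reduce p a b) (trans (eq a b) (sym (eval₂-reduce q a b)))

isotopicTo⇒isotopic : ∀ f g → IsotopicTo f g → Isotopic (eval₂ f) (eval₂ g)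
isotopicTo⇒isotopic f g (h₁ , h₂ , h₃ , p₁ , p₂ , p₃ , eq) =
  isotopy (⤖⇒↔ (mk⤖ p₁)) (⤖⇒↔ (mk⤖ p₂)) (⤖⇒↔ (mk⤖ p₃)) λ a b →
  trans (sym (evalᴾ-composite₂ g h₁ h₂ a b)) $
  trans (reduce-≡⇒evalᴾ-≡ (g [ h₁ [ X ]₁ , h₂ [ Y ]₁ ]₂) (h₃ [ f [ X , Y ]₂ ]₁) eq a b) $
  evalᴾ-composite₁ h₃ f a b

permutationPoly : 𝔽₄ ↔ 𝔽₄ → Poly₁
permutationPoly π = interp₁ (to π)

permutationPoly∈𝒫₄ : ∀ π → 𝒫₄ (permutationPoly π)
permutationPoly∈𝒫₄ π = injective⇒permutation
  (Injective-resp-≗ (sym ∘ eval₁-interp₁ (to π)) (to-injective π))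

isotopic⇒isotopicTo : ∀ f g → Isotopic (eval₂ f) (eval₂ g) → IsotopicTo f g
isotopic⇒isotopicTo f g (isotopy σ τ ρ eq) =
  h₁ , h₂ , h₃ , permutationPoly∈𝒫₄ σ , permutationPoly∈𝒫₄ τ , permutationPoly∈𝒫₄ ρ ,
  evalᴾ-≡⇒reduce-≡ (g [ h₁ [ X ]₁ , h₂ [ Y ]₁ ]₂) (h₃ [ f [ X , Y ]₂ ]₁) λ a b →
    trans (evalᴾ-composite₂ g h₁ h₂ a b) $
    trans (cong₂ (eval₂ g) (eval₁-interp₁ (to σ) a) (eval₁-interp₁ (to τ) b)) $
    trans (eq a b) $
    trans (sym (eval₁-interp₁ (to ρ) (eval₂ f a b))) $
    sym (evalᴾ-composite₁ h₃ f a b)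
  where
  h₁ = permutationPoly σ
  h₂ = permutationPoly τ
  h₃ = permutationPoly ρ

-- Canonical squares

-- canonical 0# is addition; for v ≠ 0#, canonical v is the addition table of a
-- cyclic group in which v is the element of order two, namely
-- a + b + a(a + v)b(b + v).  The factor v³ is 1 unless v = 0#.
canonical : 𝔽₄ → 𝔽₄ → 𝔽₄ → 𝔽₄
canonical v a b = a + b + v * (v * a * (a + v)) * (v * b * (b + v))

canonical-latin : ∀ v → Latin (canonical v)
canonical-latin = from-yes (∀𝔽₄? λ v →
  (∀𝔽₄? λ b → Injective? λ a → canonical v a b) ×-dec (∀𝔽₄? λ a → Injective? (canonical v a)))

-- For v ≠ 0 we have v³ = 1, so multiplication by v² = v⁻¹ carries the element v of order two to
-- `1#`.
canonical-scale : ∀ v → v ≢ 0# → ∀ a b →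
  canonical 1# (v * v * a) (v * v * b) ≡ v * v * canonical v a b
canonical-scale = from-yes (∀𝔽₄? λ v → ¬? (v ≟ 0#) →-dec ∀𝔽₄? λ a → ∀𝔽₄? λ b →
  canonical 1# (v * v * a) (v * v * b) ≟ v * v * canonical v a b)

scale-injective : ∀ v → v ≢ 0# → Injective _≡_ _≡_ (v * v *_)
scale-injective = from-yes (∀𝔽₄? λ v → ¬? (v ≟ 0#) →-dec Injective? (v * v *_))

canonical-isotopic : ∀ {v} → v ≢ 0# → Isotopic (canonical v) (canonical 1#)
canonical-isotopic {v} v≢0 = isotopy π π π (canonical-scale v v≢0)
  where π = permutation (scale-injective v v≢0)

-- The quadrangle criterion, an isotopy invariant that holds for addition but
-- not for the cyclic group.
Quadrangle : (𝔽₄ → 𝔽₄ → 𝔽₄) → Set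
Quadrangle F = ∀ a a′ b b′ → F a b ≡ F a′ b′ → F a b′ ≡ F a′ b

Quadrangle-resp : ∀ {F G} → Isotopic F G → Quadrangle G → Quadrangle F
Quadrangle-resp {F} {G} (isotopy σ τ ρ eq) quad a a′ b b′ Fab≡Fa′b′ = to-injective ρ $ begin
  to ρ (F a b′)         ≡⟨ eq a b′ ⟨
  G (to σ a) (to τ b′)  ≡⟨ quad (to σ a) (to σ a′) (to τ b) (to τ b′)
                            (trans (eq a b) (trans (cong (to ρ) Fab≡Fa′b′) (sym (eq a′ b′)))) ⟩
  G (to σ a′) (to τ b)  ≡⟨ eq a′ b ⟩
  to ρ (F a′ b)         ∎

canonical-nonisotopic : ¬ Isotopic (canonical 1#) (canonical 0#)
-- In the cyclic group with `1#` of order two, 0 + ω = ω + 0, and the criterion would give 0 + 0 = ω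
-- + ω; but ω is a generator, and its double is `1#`.
canonical-nonisotopic iso = contradiction (Quadrangle-resp iso quadrangle 0# ω ω 0# refl) λ ()
  where
  quadrangle : Quadrangle (canonical 0#)
  quadrangle = from-yes (∀𝔽₄? λ a → ∀𝔽₄? λ a′ → ∀𝔽₄? λ b → ∀𝔽₄? λ b′ →
    (canonical 0# a b ≟ canonical 0# a′ b′) →-dec (canonical 0# a b′ ≟ canonical 0# a′ b))

-- Reduction to the canonical squares

fromRows : (r₁ r₂ r₃ : Vec 𝔽₄ 4) → 𝔽₄ → 𝔽₄ → 𝔽₄
fromRows r₁ r₂ r₃ 0# = λ b → b
fromRows r₁ r₂ r₃ 1# = ⟦ r₁ ⟧
fromRows r₁ r₂ r₃ ω  = ⟦ r₂ ⟧
fromRows r₁ r₂ r₃ ω̄  = ⟦ r₃ ⟧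

Disjoint : (u w : 𝔽₄ → 𝔽₄) → Set
Disjoint u w = ∀ b → u b ≢ w b

disjoint? : ∀ u w → Dec (Disjoint u w)
disjoint? u w = ∀𝔽₄? λ b → ¬? (u b ≟ w b)

opaque
  -- The hypotheses are interleaved with the quantifiers to prune the search.
  fromRows-canonical :
    ∀ r₁ → ⟦ r₁ ⟧ 0# ≡ 1# → Injective _≡_ _≡_ ⟦ r₁ ⟧ → Disjoint (λ b → b) ⟦ r₁ ⟧ →
    ∀ r₂ → ⟦ r₂ ⟧ 0# ≡ ω  → Injective _≡_ _≡_ ⟦ r₂ ⟧ → Disjoint (λ b → b) ⟦ r₂ ⟧ →
    Disjoint ⟦ r₁ ⟧ ⟦ r₂ ⟧ →
    ∀ r₃ → ⟦ r₃ ⟧ 0# ≡ ω̄  → Injective _≡_ _≡_ ⟦ r₃ ⟧ → Disjoint (λ b → b) ⟦ r₃ ⟧ →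
    Disjoint ⟦ r₁ ⟧ ⟦ r₃ ⟧ → Disjoint ⟦ r₂ ⟧ ⟦ r₃ ⟧ →
    ∃[ v ] ∀ a b → fromRows r₁ r₂ r₃ a b ≡ canonical v a b
  fromRows-canonical = from-yes (
    ∀Vec? λ r₁ → (⟦ r₁ ⟧ 0# ≟ 1#) →-dec Injective? ⟦ r₁ ⟧ →-dec disjoint? (λ b → b) ⟦ r₁ ⟧ →-dec
    ∀Vec? λ r₂ → (⟦ r₂ ⟧ 0# ≟ ω)  →-dec Injective? ⟦ r₂ ⟧ →-dec disjoint? (λ b → b) ⟦ r₂ ⟧ →-dec
    disjoint? ⟦ r₁ ⟧ ⟦ r₂ ⟧ →-dec
    ∀Vec? λ r₃ → (⟦ r₃ ⟧ 0# ≟ ω̄)  →-dec Injective? ⟦ r₃ ⟧ →-dec disjoint? (λ b → b) ⟦ r₃ ⟧ →-dec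
    disjoint? ⟦ r₁ ⟧ ⟦ r₃ ⟧ →-dec disjoint? ⟦ r₂ ⟧ ⟦ r₃ ⟧ →-dec
    ∃𝔽₄? λ v → ∀𝔽₄? λ a → ∀𝔽₄? λ b → fromRows r₁ r₂ r₃ a b ≟ canonical v a b)

reduced⇒canonical : ∀ {F} → Latin F → (∀ a → F a 0# ≡ a) → (∀ b → F 0# b ≡ b) →
  ∃[ v ] ∀ a b → F a b ≡ canonical v a b
reduced⇒canonical {F} latin F-0 F0- =
  let v , eq = fromRows-canonical
        (row 1#) (F-0 1#) (injective 1#) (disjoint 0# 1# λ ())
        (row ω)  (F-0 ω)  (injective ω)  (disjoint 0# ω λ ()) (disjoint 1# ω λ ())
        (row ω̄)  (F-0 ω̄)  (injective ω̄)  (disjoint 0# ω̄ λ ()) (disjoint 1# ω̄ λ ()) (disjoint ω ω̄ λ ())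
  in v , λ a b → trans (F≡R a b) (eq a b)
  where
  row : 𝔽₄ → Vec 𝔽₄ 4
  row a = table (F a)

  R : 𝔽₄ → 𝔽₄ → 𝔽₄
  R = fromRows (row 1#) (row ω) (row ω̄)

  F≡R : ∀ a b → F a b ≡ R a b
  F≡R 0# b = F0- b
  F≡R 1# b = sym (⟦table⟧ (F 1#) b)
  F≡R ω  b = sym (⟦table⟧ (F ω) b)
  F≡R ω̄  b = sym (⟦table⟧ (F ω̄) b)

  injective : ∀ a → Injective _≡_ _≡_ (R a)
  injective = proj₂ (Latin-resp F≡R latin)

  -- Distinct rows agree nowhere because the columns are injective.
  disjoint : ∀ a a′ → a ≢ a′ → Disjoint (R a) (R a′)
  disjoint a a′ a≢a′ b = a≢a′ ∘ proj₁ (Latin-resp F≡R latin) b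

-- Take for ℓ the first column a ↦ F(a, 0), and for μ the first row followed by ℓ⁻¹. Then R(a, b) =
-- ℓ⁻¹(F(a, μ⁻¹(b))) has its first row and column in order. As row and column share the entry F(0,
-- 0), μ fixes 0, which leaves six candidates for μ when the degrees are enumerated.
latin⇒canonical : ∀ {F} → Latin F → 
  ∃[ v ] Σ[ ℓ ∈ 𝔽₄ ↔ 𝔽₄ ] Σ[ μ ∈ 𝔽₄ ↔ 𝔽₄ ]
  to μ 0# ≡ 0# × (∀ a b → F a b ≡ to ℓ (canonical v a (to μ b)))
latin⇒canonical {F} (columns , rows) =
  let v , eq = reduced⇒canonical R-latin R-0 R0- in
  v , ℓ , μ , μ0≡0 , λ a b → begin
  F a b                      ≡⟨ strictlyInverseˡ ℓ (F a b) ⟨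
  to ℓ (from ℓ (F a b))      ≡⟨ cong (to ℓ ∘ from ℓ ∘ F a) (strictlyInverseʳ μ b) ⟨
  to ℓ (R a (to μ b))        ≡⟨ cong (to ℓ) (eq a (to μ b)) ⟩
  to ℓ (canonical v a (to μ b)) ∎
  where
  open Inverse

  ℓ μ : 𝔽₄ ↔ 𝔽₄
  ℓ = permutation (columns 0#)
  μ = ↔-trans (permutation (rows 0#)) (↔-sym ℓ)

  R : 𝔽₄ → 𝔽₄ → 𝔽₄
  R a b = from ℓ (F a (from μ b))

  R-latin : Latin R
  R-latin = (λ b → columns (from μ b) ∘ to-injective (↔-sym ℓ))
          , (λ a → to-injective (↔-sym μ) ∘ rows a ∘ to-injective (↔-sym ℓ))

  μ0≡0 : to μ 0# ≡ 0#
  μ0≡0 = strictlyInverseʳ ℓ 0#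

  R-0 : ∀ a → R a 0# ≡ a
  R-0 a = begin
    from ℓ (F a (from μ 0#))        ≡⟨ cong (from ℓ ∘ F a ∘ from μ) μ0≡0 ⟨
    from ℓ (F a (from μ (to μ 0#))) ≡⟨ cong (from ℓ ∘ F a) (strictlyInverseʳ μ 0#) ⟩
    from ℓ (F a 0#)                 ≡⟨ strictlyInverseʳ ℓ a ⟩
    a                               ∎

  R0- : ∀ b → R 0# b ≡ b
  -- By the choice of μ, R(0, b) unfolds to μ(μ⁻¹(b)).
  R0- = strictlyInverseˡ μ

-- Degrees

HasTotalDegree? : ∀ f d → Dec (HasTotalDegree f d)
HasTotalDegree? f d =
  any? (λ i → any? λ j → ¬? (coeff₂ f i j ≟ 0#) ×-dec (toℕ i ℕ.+ toℕ j ℕ.≟ d))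
  ×-dec
  all? (λ i → all? λ j → ¬? (coeff₂ f i j ≟ 0#) →-dec (toℕ i ℕ.+ toℕ j ℕ.≤? d))

HasTotalDegree-unique : ∀ {f d e} → HasTotalDegree f d → HasTotalDegree f e → d ≡ e
HasTotalDegree-unique ((i , j , f≢0 , i+j≡d) , ≤d) ((k , l , f≢0′ , k+l≡e) , ≤e) =
  ℕ.≤-antisym (subst (ℕ._≤ _) i+j≡d (≤e i j f≢0)) (subst (ℕ._≤ _) k+l≡e (≤d k l f≢0′))

opaque
  squarePoly : 𝔽₄ → (s t : Vec 𝔽₄ 4) → Poly₂
  squarePoly v s t = interp₂ λ a b → ⟦ s ⟧ (canonical v a (⟦ t ⟧ b))

  eval₂-squarePoly : ∀ v s t a b → eval₂ (squarePoly v s t) a b ≡ ⟦ s ⟧ (canonical v a (⟦ t ⟧ b))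
  eval₂-squarePoly v s t = eval₂-interp₂ λ a b → ⟦ s ⟧ (canonical v a (⟦ t ⟧ b))

  -- Behind the enumeration: every permutation of 𝔽₄ is affine over 𝔽₂, that is, of the form c + αx
  -- + βx². Hence s(a + t(b)) has no mixed terms and degree 1 or 2.
  degree-additive : ∀ s → Injective _≡_ _≡_ ⟦ s ⟧ → ∀ t → Injective _≡_ _≡_ ⟦ t ⟧ → ⟦ t ⟧ 0# ≡ 0# →
    HasTotalDegree (squarePoly 0# s t) 1 ⊎ HasTotalDegree (squarePoly 0# s t) 2
  degree-additive = from-yes (
    ∀Vec? λ s → Injective? ⟦ s ⟧ →-dec ∀Vec? λ t → Injective? ⟦ t ⟧ →-dec (⟦ t ⟧ 0# ≟ 0#) →-dec
    (HasTotalDegree? (squarePoly 0# s t) 1 ⊎-dec HasTotalDegree? (squarePoly 0# s t) 2))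

  -- Behind the enumeration: the correction term takes only the values 0 and v, so the linear part
  -- of s multiplies it by a nonzero constant. Since t is additive, t(b)(t(b) + v) is additive in b
  -- with a kernel of order two, so its b² coefficient is nonzero. Thus x²y² survives, and no
  -- exponent exceeds 2.
  degree-cyclic : ∀ v → v ≢ 0# →
    ∀ s → Injective _≡_ _≡_ ⟦ s ⟧ → ∀ t → Injective _≡_ _≡_ ⟦ t ⟧ → ⟦ t ⟧ 0# ≡ 0# →
    HasTotalDegree (squarePoly v s t) 4
  degree-cyclic = from-yes (∀𝔽₄? λ v → ¬? (v ≟ 0#) →-dec
    ∀Vec? λ s → Injective? ⟦ s ⟧ →-dec ∀Vec? λ t → Injective? ⟦ t ⟧ →-dec (⟦ t ⟧ 0# ≟ 0#) →-dec
    HasTotalDegree? (squarePoly v s t) 4)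

-- The two isotopism classes and their degrees

opaque
  canonicalPoly : 𝔽₄ → Poly₂
  canonicalPoly v = interp₂ (canonical v)

  eval₂-canonicalPoly : ∀ v a b → eval₂ (canonicalPoly v) a b ≡ canonical v a b
  eval₂-canonicalPoly v = eval₂-interp₂ (canonical v)

canonicalPoly∈ℒ𝒫₄ : ∀ v → ℒ𝒫₄ (canonicalPoly v)
canonicalPoly∈ℒ𝒫₄ v = Latin⇒ℒ𝒫₄ {canonicalPoly v}
  (Latin-resp (λ a b → sym (eval₂-canonicalPoly v a b)) (canonical-latin v))

canonicalPoly-isotopic : ∀ v → Isotopic (eval₂ (canonicalPoly v)) (canonical v)
canonicalPoly-isotopic v = Isotopic-reflexive (eval₂-canonicalPoly v)

∈class⇒isotopic : ∀ v f → isotopismClass (canonicalPoly v) f → Isotopic (eval₂ f) (canonical v)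
∈class⇒isotopic v f (_ , iso) = Isotopic-trans
  (Isotopic-sym (isotopicTo⇒isotopic (canonicalPoly v) f iso)) (canonicalPoly-isotopic v)

isotopic⇒∈class : ∀ v f → ℒ𝒫₄ f → Isotopic (eval₂ f) (canonical v) → isotopismClass (canonicalPoly v) f
isotopic⇒∈class v f f∈ iso = f∈ , isotopic⇒isotopicTo (canonicalPoly v) f
  (Isotopic-trans (canonicalPoly-isotopic v) (Isotopic-sym iso))

-- Degree and isotopy type are recorded together, so that either one determines the other once the
-- opposite case is excluded.
Classified : Poly₂ → Set
Classified f =
  ((ℒ𝒫₄[ 1 ] ∪ ℒ𝒫₄[ 2 ]) f × Isotopic (eval₂ f) (canonical 0#)) ⊎
  (ℒ𝒫₄[ 4 ] f × Isotopic (eval₂ f) (canonical 1#))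

module _ f (f∈ : ℒ𝒫₄ f) v (ℓ μ : 𝔽₄ ↔ 𝔽₄) (μ0≡0 : to μ 0# ≡ 0#)
         (eq : ∀ a b → eval₂ f a b ≡ to ℓ (canonical v a (to μ b))) where

  private
    s t : Vec 𝔽₄ 4
    s = table (to ℓ)
    t = table (to μ)

    squarePoly≡f : squarePoly v s t ≡ f
    squarePoly≡f = eval₂-injective λ a b → begin
      eval₂ (squarePoly v s t) a b    ≡⟨ eval₂-squarePoly v s t a b ⟩
      ⟦ s ⟧ (canonical v a (⟦ t ⟧ b)) ≡⟨ ⟦table⟧ (to ℓ) _ ⟩
      to ℓ (canonical v a (⟦ t ⟧ b))  ≡⟨ cong (to ℓ ∘ canonical v a) (⟦table⟧ (to μ) b) ⟩
      to ℓ (canonical v a (to μ b))   ≡⟨ eq a b ⟨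
      eval₂ f a b                     ∎

    iso : Isotopic (eval₂ f) (canonical v)
    iso = isotopy ↔-refl μ (↔-sym ℓ) λ a b →
      trans (sym (Inverse.strictlyInverseʳ ℓ _)) (cong (from ℓ) (sym (eq a b)))

    s-inj : Injective _≡_ _≡_ ⟦ s ⟧
    s-inj = ⟦table⟧-injective (to-injective ℓ)

    t-inj : Injective _≡_ _≡_ ⟦ t ⟧
    t-inj = ⟦table⟧-injective (to-injective μ)

  -- The tables of ℓ and μ exhibit `f` as one of the squares whose degree was checked. For v ≠ 0,
  -- scaling moves the isotopy type to that of `1#`.
  classify : Dec (v ≡ 0#) → Classified f
  classify (yes v≡0) = inj₁
    ( Sum.map (λ d → f∈ , degree 1 d) (λ d → f∈ , degree 2 d)
        (degree-additive s s-inj t t-inj μ0≡0)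
    , subst (Isotopic (eval₂ f) ∘ canonical) v≡0 iso )
    where
    degree : ∀ d → HasTotalDegree (squarePoly 0# s t) d → HasTotalDegree f d
    degree d = subst (λ g → HasTotalDegree g d)
      (trans (cong (λ w → squarePoly w s t) (sym v≡0)) squarePoly≡f)
  classify (no v≢0) = inj₂
    ( (f∈ , subst (λ g → HasTotalDegree g 4) squarePoly≡f
              (degree-cyclic v v≢0 s s-inj t t-inj μ0≡0))
    , Isotopic-trans iso (canonical-isotopic v≢0) )

classification : ∀ f → ℒ𝒫₄ f → Classified f
classification f f∈ =
  let v , ℓ , μ , μ0≡0 , eq = latin⇒canonical (ℒ𝒫₄⇒Latin {f} f∈)
  in classify f f∈ v ℓ μ μ0≡0 eq (v ≟ 0#)

degree₁₂-degree₄-disjoint : (ℒ𝒫₄[ 1 ] ∪ ℒ𝒫₄[ 2 ]) ⊥ ℒ𝒫₄[ 4 ]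
degree₁₂-degree₄-disjoint {f} (inj₁ (_ , d) , (_ , e)) = contradiction (HasTotalDegree-unique {f} d e) λ ()
degree₁₂-degree₄-disjoint {f} (inj₂ (_ , d) , (_ , e)) = contradiction (HasTotalDegree-unique {f} d e) λ ()

degree₁₂⇒ℒ𝒫₄ : ∀ {f} → (ℒ𝒫₄[ 1 ] ∪ ℒ𝒫₄[ 2 ]) f → ℒ𝒫₄ f
degree₁₂⇒ℒ𝒫₄ (inj₁ (f∈ , _)) = f∈
degree₁₂⇒ℒ𝒫₄ (inj₂ (f∈ , _)) = f∈

-- The classification leaves one wrong case in each direction: uniqueness of the degree excludes it
-- from left to right, and nonisotopy of the canonical squares from right to left.
degree₁₂≐additiveClass : (ℒ𝒫₄[ 1 ] ∪ ℒ𝒫₄[ 2 ]) ≐ isotopismClass (canonicalPoly 0#)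
degree₁₂≐additiveClass =
    (λ {f} f∈ → ⊆ f f∈ (classification f (degree₁₂⇒ℒ𝒫₄ {f} f∈)))
  , (λ {f} f∈ → ⊇ f (∈class⇒isotopic 0# f f∈) (classification f (proj₁ f∈)))
  where
  ⊆ : ∀ f → (ℒ𝒫₄[ 1 ] ∪ ℒ𝒫₄[ 2 ]) f → Classified f → isotopismClass (canonicalPoly 0#) f
  ⊆ f f∈ (inj₁ (_ , iso)) = isotopic⇒∈class 0# f (degree₁₂⇒ℒ𝒫₄ {f} f∈) iso
  ⊆ f f∈ (inj₂ (f∈₄ , _)) = contradiction (f∈ , f∈₄) (degree₁₂-degree₄-disjoint {f})

  ⊇ : ∀ f → Isotopic (eval₂ f) (canonical 0#) → Classified f → (ℒ𝒫₄[ 1 ] ∪ ℒ𝒫₄[ 2 ]) f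
  ⊇ f iso (inj₁ (f∈₁₂ , _)) = f∈₁₂
  ⊇ f iso (inj₂ (_ , iso′)) =
    contradiction (Isotopic-trans (Isotopic-sym iso′) iso) canonical-nonisotopic

degree₄≐cyclicClass : ℒ𝒫₄[ 4 ] ≐ isotopismClass (canonicalPoly 1#)
degree₄≐cyclicClass =
    (λ {f} f∈ → ⊆ f f∈ (classification f (proj₁ f∈)))
  , (λ {f} f∈ → ⊇ f (∈class⇒isotopic 1# f f∈) (classification f (proj₁ f∈)))
  where
  ⊆ : ∀ f → ℒ𝒫₄[ 4 ] f → Classified f → isotopismClass (canonicalPoly 1#) f
  ⊆ f f∈ (inj₁ (f∈₁₂ , _)) = contradiction (f∈₁₂ , f∈) (degree₁₂-degree₄-disjoint {f})
  ⊆ f f∈ (inj₂ (_ , iso))  = isotopic⇒∈class 1# f (proj₁ f∈) iso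

  ⊇ : ∀ f → Isotopic (eval₂ f) (canonical 1#) → Classified f → ℒ𝒫₄[ 4 ] f
  ⊇ f iso (inj₁ (_ , iso′)) =
    contradiction (Isotopic-trans (Isotopic-sym iso) iso′) canonical-nonisotopic
  ⊇ f iso (inj₂ (f∈₄ , _)) = f∈₄

-- Isotopy is symmetric and transitive, so a class does not depend on its representative.
isotopic⇒class≐ : ∀ v f → Isotopic (eval₂ f) (canonical v) →
  isotopismClass f ≐ isotopismClass (canonicalPoly v)
isotopic⇒class≐ v f iso =
    (λ {g} (g∈ , i) → isotopic⇒∈class v g g∈
      (Isotopic-trans (Isotopic-sym (isotopicTo⇒isotopic f g i)) iso))
  , (λ {g} g∈ → proj₁ g∈ , isotopic⇒isotopicTo f g
      (Isotopic-trans iso (Isotopic-sym (∈class⇒isotopic v g g∈))))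

corollary4p1 :
  (ℒ𝒫₄[ 1 ] ⊥ ℒ𝒫₄[ 2 ])
  × IsIsotopismClass (ℒ𝒫₄[ 1 ] ∪ ℒ𝒫₄[ 2 ])
  × IsIsotopismClass ℒ𝒫₄[ 4 ]
  × ((ℒ𝒫₄[ 1 ] ∪ ℒ𝒫₄[ 2 ]) ⊥ ℒ𝒫₄[ 4 ])
  × (ℒ𝒫₄ ≐ ((ℒ𝒫₄[ 1 ] ∪ ℒ𝒫₄[ 2 ]) ∪ ℒ𝒫₄[ 4 ]))
  × (∀ (C : Pred Poly₂ 0ℓ) → IsIsotopismClass C → (C ≐ (ℒ𝒫₄[ 1 ] ∪ ℒ𝒫₄[ 2 ])) ⊎ (C ≐ ℒ𝒫₄[ 4 ]))
corollary4p1 =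
    (λ {f} ((_ , d) , (_ , e)) → contradiction (HasTotalDegree-unique {f} d e) λ ())
  , (canonicalPoly 0# , canonicalPoly∈ℒ𝒫₄ 0# , degree₁₂≐additiveClass)
  , (canonicalPoly 1# , canonicalPoly∈ℒ𝒫₄ 1# , degree₄≐cyclicClass)
  , (λ {f} → degree₁₂-degree₄-disjoint {f})
  , ( (λ {f} f∈ → Sum.map proj₁ proj₁ (classification f f∈))
    , (λ {f} → λ { (inj₁ f∈₁₂) → degree₁₂⇒ℒ𝒫₄ {f} f∈₁₂ ; (inj₂ (f∈ , _)) → f∈ }) )
  -- Classifying a representative of C tells which canonical polynomial can replace it.
  , λ C (f , f∈ , C≐) → Sum.map
      (λ (_ , iso) → ≐-trans C≐ (≐-trans (isotopic⇒class≐ 0# f iso) (≐-sym degree₁₂≐additiveClass)))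
      (λ (_ , iso) → ≐-trans C≐ (≐-trans (isotopic⇒class≐ 1# f iso) (≐-sym degree₄≐cyclicClass)))
      (classification f f∈)
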